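{- Let $n\ge 4$ be an integer. (1) For every integer $\ell$ with $2\leq \ell \leq n-1$, $e_{n-1}(n,\ell,n-1)=n-1$. (2) For every integer $\ell$ with $2\leq \ell \leq n-1$, $e_{n-1}(n,\ell,n-2)=n+\ell-2$.
   Context: All graphs are finite, simple and undirected; $e(G)$ is the number of edges of $G$ and $\Delta(G)$ its maximum degree. For a graph $G$ and a nonempty set $S\subseteq V(G)$, the Steiner distance $d_G(S)$ is the minimum number of edges of a connected subgraph of $G$ whose vertex set contains $S$, with $d_G(S)=\infty$ if there is no such subgraph. For $2\le k\le n=|V(G)|$, the Steiner $k$-diameter is $sdiam_k(G)=\max\{d_G(S) : S\subseteq V(G),\ |S|=k\}$ (so it is $\infty$ if some $k$-set lies in no connected subgraph). For natural numbers $n,\ell,d$ with $\ell<n$ and $d<n$, $\mathscr{H}_k(n,\ell,d)$ is the set of all graphs $G$ of order $n$ with maximum degree exactly $\ell$ and $sdiam_k(G)\le d$, and $e_k(n,\ell,d)=\min\{e(G): G\in\mathscr{H}_k(n,\ell,d)\}$, with $e_k(n,\ell,d)=\infty$ if $\mathscr{H}_k(n,\ell,d)$ is empty. The parameter $k$ is assumed to satisfy $3\le k\le n$. -}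

module Defs where

open import Data.Bool.Base using (Bool; true; false; _∧_; if_then_else_)
open import Data.Fin.Base using (Fin)
open import Data.Fin.Properties using (_<?_)
open import Data.Fin.Subset using (Subset; _∈_; _⊆_; ∣_∣)
open import Data.List.Base using (map; allFin)
open import Data.List.Extrema.Nat using (max)
open import Data.Nat.Base using (ℕ; _≤_)
open import Data.Nat.Properties using (+-0-commutativeMonoid)
open import Data.Product.Base using (_×_; ∃-syntax)
open import Relation.Binary.Construct.Closure.ReflexiveTransitive using (Star)
open import Relation.Binary.PropositionalEquality.Core using (_≡_)
open import Relation.Nullary.Construct.Add.Supremum public using (_⁺; ⊤⁺; [_])
open import Relation.Nullary.Decidable.Core using (does)
open import Relation.Nullary.Negation.Core using (¬_)
open import Relation.Binary.Construct.Add.Supremum.NonStrict _≤_ using (_≤⁺_)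
open import Algebra.Properties.CommutativeMonoid.Sum +-0-commutativeMonoid
  using (sum-syntax)

ℕ∞ : Set
ℕ∞ = ℕ ⁺

-- Minima and maxima are specified as relations.  The minimum of an empty
-- set of natural numbers is ⊤⁺ (infinity).

IsMinimum : (ℕ → Set) → ℕ∞ → Set
IsMinimum P [ m ] = P m × (∀ x → P x → m ≤ x)
IsMinimum P ⊤⁺    = ∀ x → ¬ P x

IsMaximum : (ℕ∞ → Set) → ℕ∞ → Set
IsMaximum P m = P m × (∀ x → P x → x ≤⁺ m)

record Graph (n : ℕ) : Set where
  field
    adj         : Fin n → Fin n → Bool
    symmetric   : ∀ u v → adj u v ≡ adj v u
    irreflexive : ∀ v → adj v v ≡ false

  Adjacent : Fin n → Fin n → Set
  Adjacent u v = adj u v ≡ true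

  degree : Fin n → ℕ
  degree u = ∑[ v < n ] (if adj u v then 1 else 0)

  Δ : ℕ
  Δ = max 0 (map degree (allFin n))

  -- Each edge is counted once, as the pair (u , v) with u < v.
  e : ℕ
  e = ∑[ u < n ] ∑[ v < n ] (if does (u <? v) ∧ adj u v then 1 else 0)

open Graph public using (Adjacent; Δ; e)

-- The edge set of a subgraph is stored as a graph on all n vertices;
-- edges-within makes every vertex outside `vertices` isolated in it.
record Subgraph {n : ℕ} (G : Graph n) : Set where
  field
    vertices     : Subset n
    edges        : Graph n
    edges-of-G   : ∀ {u v} → Adjacent edges u v → Adjacent G u v
    edges-within : ∀ {u v} → Adjacent edges u v → u ∈ vertices × v ∈ vertices

  Connected : Set
  Connected = ∀ {u v} → u ∈ vertices → v ∈ vertices → Star (Adjacent edges) u v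

open Subgraph public using (vertices; edges; Connected)

-- d_G(S) = d
IsSteinerDistance : ∀ {n} → Graph n → Subset n → ℕ∞ → Set
IsSteinerDistance G S = IsMinimum λ m →
  ∃[ H ] (Connected {G = G} H × S ⊆ vertices H × e (edges H) ≡ m)

-- sdiam_k(G) = D
IsSteinerDiameter : ∀ {n} → ℕ → Graph n → ℕ∞ → Set
IsSteinerDiameter k G = IsMaximum λ d →
  ∃[ S ] (∣ S ∣ ≡ k × IsSteinerDistance G S d)

-- G ∈ ℋ_k(n, ℓ, d)
ℋ : (k n ℓ d : ℕ) → Graph n → Set
ℋ k n ℓ d G = Δ G ≡ ℓ × ∃[ D ] (IsSteinerDiameter k G D × D ≤⁺ [ d ])

-- e_k(n, ℓ, d) = m
IsMinimumSize : (k n ℓ d : ℕ) → ℕ∞ → Set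
IsMinimumSize k n ℓ d = IsMinimum λ m → ∃[ G ] (ℋ k n ℓ d G × e G ≡ m)

{-# OPTIONS --safe #-}
module Submission where

-- A connected graph on w vertices has at least w - 1 edges, which bounds the size of any G of
-- finite (n - 1)-diameter below by n - 1; a broom with ℓ edges at its centre attains this.  The
-- (n - 1)-diameter is n - 2 only if every G - v is connected; taking v of degree ℓ, the ℓ edges
-- at v come on top of the n - 2 edges of a connected subgraph spanning G - v.  A cycle with ℓ - 2
-- chords from one vertex attains n + ℓ - 2.  Steiner distances are not computed: their existence
-- up to double negation suffices, because the lower bounds are decidable.

open import Defs
open import Data.Bool.Base using (true; false; if_then_else_)
open import Data.Empty using (⊥-elim)
open import Data.Fin.Base using (Fin; zero; suc; toℕ; fromℕ; inject₁)
import Data.Fin.Base as Fin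
open import Data.Fin.Induction using (<-weakInduction; >-weakInduction)
open import Data.Fin.Properties
  using (_≟_; _<?_; any?; ¬∀⟶∃¬; <-cmp; <⇒≢; toℕ-fromℕ; toℕ-inject₁;
         toℕ-injective; ≤fromℕ; fromℕ≢inject₁; inject₁-injective)
open import Data.Fin.Relation.Unary.Top using (view; ‵fromℕ; ‵inject₁)
open import Data.Fin.Subset
  using (Subset; inside; outside; ⊤; ∁; ⁅_⁆; _∪_; _∈_; _∉_; _⊆_; ∣_∣)
open import Data.Fin.Subset.Properties
  using (_∈?_; nonempty?; Empty-unique; ∈⊤; ⊆⊤; ∣⊥∣≡0; ∣⊤∣≡n; ∣p∣≤n; ∣⁅x⁆∣≡1; ∣∁p∣≡n∸∣p∣;
         x∈⁅x⁆; x∈⁅y⁆⇒x≡y; x≢y⇒x∉⁅y⁆; x∉p⇒x∈∁p; x∈∁p⇒x∉p; p⊆p∪q; q⊆p∪q; x∈p∪q⁻;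
         p⊆q⇒∣p∣≤∣q∣; p⊂q⇒∣p∣<∣q∣)
open import Data.List.Base using (map; allFin)
open import Data.List.Extrema.Nat using (max≈v⁺; argmax-sel)
open import Data.List.Membership.Propositional.Properties using (∈-map⁺; ∈-map⁻; ∈-allFin)
import Data.List.Relation.Unary.All.Properties as All
open import Data.Nat.Base
  using (ℕ; zero; suc; _≤_; _<_; _+_; _∸_; z≤n; s≤s; s≤s⁻¹; z<s; s<s⁻¹)
import Data.Nat as ℕ
import Data.Nat.Properties as ℕ
open import Data.Nat.Induction using (<-rec)
open import Data.Product.Base using (_×_; _,_; proj₁; proj₂; ∃-syntax)
open import Data.Sum.Base as Sum using (_⊎_; inj₁; inj₂; [_,_]′)
open import Data.Vec.Base using ([]; _∷_)
open import Function.Base using (_∘_; id; _$_)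
open import Function.Bundles using (mk⇔)
open import Relation.Binary.Construct.Closure.ReflexiveTransitive as Star using (Star; ε; _◅_; _◅◅_)
open import Relation.Binary.Construct.Add.Supremum.NonStrict _≤_ using (_≤⁺_; [_]; ≤⁺-trans)
open import Relation.Binary.Definitions using (Decidable; tri<; tri≈; tri>)
open import Relation.Binary.PropositionalEquality
  using (_≡_; _≢_; refl; sym; trans; cong; cong₂; subst; ≢-sym; module ≡-Reasoning)
open import Relation.Nullary
  using (¬_; Dec; yes; no; does; _because_; Reflects; ofʸ; ofⁿ; ¬?; _×-dec_; _⊎-dec_;
         ⊤-dec; contradiction; decidable-stable)
open import Relation.Nullary.Decidable using (dec-true; dec-false; does-⇔)
open import Algebra.Properties.CommutativeMonoid.Sum ℕ.+-0-commutativeMonoid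
  using (sum-syntax; sum-cong-≗; sum-replicate-zero; ∑-distrib-+; ∑-comm)

open Graph using (adj; symmetric; irreflexive; degree)

private
  variable
    k m n d : ℕ
    A B C : Set

-- Sums of indicators of decidable propositions.

⟦_⟧ : Dec A → ℕ
⟦ a? ⟧ = if does a? then 1 else 0

⟦⟧≤1 : (a? : Dec A) → ⟦ a? ⟧ ≤ 1
⟦⟧≤1 (yes _) = s≤s z≤n
⟦⟧≤1 (no _)  = z≤n

⟦⟧-true : (a? : Dec A) → A → ⟦ a? ⟧ ≡ 1
⟦⟧-true (yes _) a = refl
⟦⟧-true (no ¬a) a = contradiction a ¬a

⟦⟧-false : (a? : Dec A) → ¬ A → ⟦ a? ⟧ ≡ 0
⟦⟧-false (yes a) ¬a = contradiction a ¬a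
⟦⟧-false (no _)  ¬a = refl

⟦⟧-mono : (a? : Dec A) (b? : Dec B) → (A → B) → ⟦ a? ⟧ ≤ ⟦ b? ⟧
⟦⟧-mono (yes a) b? f = ℕ.≤-reflexive (sym (⟦⟧-true b? (f a)))
⟦⟧-mono (no _)  b? f = z≤n

-- Three counting patterns recur below: `cover` is the union bound, `pack` places disjoint cases
-- inside a larger one, and `partition` combines both into an equality.
⟦⟧-cover : (a? : Dec A) (b? : Dec B) (c? : Dec C) → (A → B ⊎ C) → ⟦ a? ⟧ ≤ ⟦ b? ⟧ + ⟦ c? ⟧
⟦⟧-cover a? (yes _) c? f = ℕ.≤-trans (⟦⟧≤1 a?) (s≤s z≤n)
⟦⟧-cover a? (no ¬b) c? f = ⟦⟧-mono a? c? λ a → [ (λ b → contradiction b ¬b) , id ]′ (f a)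

⟦⟧-pack : (a? : Dec A) (b? : Dec B) (c? : Dec C) →
          (B → A) → (C → A) → (B → ¬ C) → ⟦ b? ⟧ + ⟦ c? ⟧ ≤ ⟦ a? ⟧
⟦⟧-pack a? (no _)  c? f g h = ⟦⟧-mono c? a? g
⟦⟧-pack a? (yes b) c? f g h rewrite ⟦⟧-true a? (f b) | ⟦⟧-false c? (h b) = ℕ.≤-refl

⟦⟧-partition : (a? : Dec A) (b? : Dec B) (c? : Dec C) →
               (A → B ⊎ C) → (B → A) → (C → A) → (B → ¬ C) → ⟦ a? ⟧ ≡ ⟦ b? ⟧ + ⟦ c? ⟧
⟦⟧-partition a? b? c? p f g h = ℕ.≤-antisym (⟦⟧-cover a? b? c? p) (⟦⟧-pack a? b? c? f g h)

∑-mono : {f g : Fin n → ℕ} → (∀ i → f i ≤ g i) → ∑[ i < n ] f i ≤ ∑[ i < n ] g i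
∑-mono {zero}  f≤g = z≤n
∑-mono {suc n} f≤g = ℕ.+-mono-≤ (f≤g zero) (∑-mono (f≤g ∘ suc))

∑∑-mono : {f g : Fin n → Fin n → ℕ} → (∀ i j → f i j ≤ g i j) →
          ∑[ i < n ] ∑[ j < n ] f i j ≤ ∑[ i < n ] ∑[ j < n ] g i j
∑∑-mono f≤g = ∑-mono λ i → ∑-mono (f≤g i)

∑∑-distrib-+ : (f g : Fin n → Fin n → ℕ) →
  ∑[ i < n ] ∑[ j < n ] (f i j + g i j) ≡
  ∑[ i < n ] ∑[ j < n ] f i j + ∑[ i < n ] ∑[ j < n ] g i j
∑∑-distrib-+ f g = trans (sum-cong-≗ λ i → ∑-distrib-+ (f i) (g i)) 
  (∑-distrib-+ (λ i → ∑[ j < _ ] f i j) (λ i → ∑[ j < _ ] g i j))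

∑-zero : {f : Fin n → ℕ} → (∀ i → f i ≡ 0) → ∑[ i < n ] f i ≡ 0
∑-zero {n} f≡0 = trans (sum-cong-≗ f≡0) (sum-replicate-zero n)

∑-one : {f : Fin n → ℕ} → (∀ i → f i ≡ 1) → ∑[ i < n ] f i ≡ n
∑-one {zero}  f≡1 = refl
∑-one {suc n} f≡1 = cong₂ _+_ (f≡1 zero) (∑-one (f≡1 ∘ suc))

-- A Kronecker delta: only the summand at `x` survives. This lets a sum over neighbours be rewritten
-- as a double sum over pairs.
∑-pick : (x : Fin n) {P : Fin n → Set} (P? : ∀ i → Dec (P i)) →
         ∑[ i < n ] ⟦ i ≟ x ×-dec P? i ⟧ ≡ ⟦ P? x ⟧
∑-pick {suc n} zero P? = begin
  ⟦ P? zero ⟧ + ∑[ i < n ] 0  ≡⟨ cong (⟦ P? zero ⟧ +_) (sum-replicate-zero n) ⟩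
  ⟦ P? zero ⟧ + 0             ≡⟨ ℕ.+-identityʳ _ ⟩
  ⟦ P? zero ⟧                 ∎
  where open ≡-Reasoning
∑-pick {suc n} (suc x) P? = ∑-pick x (P? ∘ suc)

∑-≟ : (x : Fin n) → ∑[ i < n ] ⟦ i ≟ x ⟧ ≡ 1
∑-≟ {suc n} zero    = cong suc (sum-replicate-zero n)
∑-≟ {suc n} (suc x) = ∑-≟ x

∑-<? : ∀ k → k ≤ n → ∑[ i < n ] ⟦ toℕ i ℕ.<? k ⟧ ≡ k
∑-<? {n}     zero    _         = sum-replicate-zero n
∑-<? {suc n} (suc k) (s≤s k≤n) = cong suc (∑-<? k k≤n)

module _ {P Q R : Fin n → Set}
         (P? : ∀ i → Dec (P i)) (Q? : ∀ i → Dec (Q i)) (R? : ∀ i → Dec (R i)) where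

  ∑-cover : (∀ i → P i → Q i ⊎ R i) →
            ∑[ i < n ] ⟦ P? i ⟧ ≤ ∑[ i < n ] ⟦ Q? i ⟧ + ∑[ i < n ] ⟦ R? i ⟧
  ∑-cover P⇒Q⊎R = ℕ.≤-trans
    (∑-mono λ i → ⟦⟧-cover (P? i) (Q? i) (R? i) (P⇒Q⊎R i))
    (ℕ.≤-reflexive (∑-distrib-+ (λ i → ⟦ Q? i ⟧) (λ i → ⟦ R? i ⟧)))

  ∑-pack : (∀ i → Q i → P i) → (∀ i → R i → P i) → (∀ i → Q i → ¬ R i) →
           ∑[ i < n ] ⟦ Q? i ⟧ + ∑[ i < n ] ⟦ R? i ⟧ ≤ ∑[ i < n ] ⟦ P? i ⟧
  ∑-pack Q⇒P R⇒P Q⇒¬R = ℕ.≤-trans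
    (ℕ.≤-reflexive (sym (∑-distrib-+ (λ i → ⟦ Q? i ⟧) (λ i → ⟦ R? i ⟧))))
    (∑-mono λ i → ⟦⟧-pack (P? i) (Q? i) (R? i) (Q⇒P i) (R⇒P i) (Q⇒¬R i))

  ∑-partition : (∀ i → P i → Q i ⊎ R i) →
                (∀ i → Q i → P i) → (∀ i → R i → P i) → (∀ i → Q i → ¬ R i) →
                ∑[ i < n ] ⟦ P? i ⟧ ≡ ∑[ i < n ] ⟦ Q? i ⟧ + ∑[ i < n ] ⟦ R? i ⟧
  ∑-partition P⇒Q⊎R Q⇒P R⇒P Q⇒¬R = ℕ.≤-antisym (∑-cover P⇒Q⊎R) (∑-pack Q⇒P R⇒P Q⇒¬R)

-- Cardinalities of subsets.

∣p∣≡∑∈ : (p : Subset n) → ∣ p ∣ ≡ ∑[ i < n ] ⟦ i ∈? p ⟧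
∣p∣≡∑∈ [] = refl
∣p∣≡∑∈ (inside  ∷ p) = cong suc (∣p∣≡∑∈ p)
∣p∣≡∑∈ (outside ∷ p) = ∣p∣≡∑∈ p

∣p∪⁅x⁆∣≤1+∣p∣ : (p : Subset n) (x : Fin n) → ∣ p ∪ ⁅ x ⁆ ∣ ≤ suc ∣ p ∣
∣p∪⁅x⁆∣≤1+∣p∣ {n} p x = begin
  ∣ p ∪ ⁅ x ⁆ ∣
    ≡⟨ ∣p∣≡∑∈ (p ∪ ⁅ x ⁆) ⟩
  ∑[ i < n ] ⟦ i ∈? p ∪ ⁅ x ⁆ ⟧
    ≤⟨ ∑-cover (_∈? p ∪ ⁅ x ⁆) (_≟ x) (_∈? p)
         (λ _ → [ inj₂ , inj₁ ∘ x∈⁅y⁆⇒x≡y x ]′ ∘ x∈p∪q⁻ p ⁅ x ⁆) ⟩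
  ∑[ i < n ] ⟦ i ≟ x ⟧ + ∑[ i < n ] ⟦ i ∈? p ⟧
    ≡⟨ cong₂ _+_ (∑-≟ x) (sym (∣p∣≡∑∈ p)) ⟩
  suc ∣ p ∣ ∎
  where open ℕ.≤-Reasoning

∣p∣<n⇒∃∉ : (p : Subset n) → ∣ p ∣ < n → ∃[ x ] x ∉ p
∣p∣<n⇒∃∉ {n} p ∣p∣<n = ¬∀⟶∃¬ n (_∈ p) (_∈? p) λ all →
  ℕ.<⇒≱ ∣p∣<n (ℕ.≤-trans (ℕ.≤-reflexive (sym (∣⊤∣≡n n))) (p⊆q⇒∣p∣≤∣q∣ {p = ⊤} {q = p} λ {x} _ → all x))

∣∁⁅x⁆∣≡n : (x : Fin (suc n)) → ∣ ∁ ⁅ x ⁆ ∣ ≡ n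
∣∁⁅x⁆∣≡n x = trans (∣∁p∣≡n∸∣p∣ ⁅ x ⁆) (cong (suc _ ∸_) (∣⁅x⁆∣≡1 x))

≢⇒∈∁⁅⁆ : {x y : Fin n} → x ≢ y → x ∈ ∁ ⁅ y ⁆
≢⇒∈∁⁅⁆ = x∉p⇒x∈∁p ∘ x≢y⇒x∉⁅y⁆

∈∁⁅⁆⇒≢ : {x y : Fin n} → x ∈ ∁ ⁅ y ⁆ → x ≢ y
∈∁⁅⁆⇒≢ x∈ refl = x∈∁p⇒x∉p x∈ (x∈⁅x⁆ _)

-- Supplies a vertex whose complement contains both `x` and `y`.
avoid-two : 2 < n → (x y : Fin n) → ∃[ z ] x ≢ z × y ≢ z
avoid-two 2<n x y =
  let z , z∉ = ∣p∣<n⇒∃∉ (⁅ x ⁆ ∪ ⁅ y ⁆) (ℕ.≤-trans (s≤s ∣xy∣≤2) 2<n) in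
  z , (λ x≡z → z∉ (p⊆p∪q ⁅ y ⁆ (subst (_∈ ⁅ x ⁆) x≡z (x∈⁅x⁆ x))))
    , (λ y≡z → z∉ (q⊆p∪q ⁅ x ⁆ ⁅ y ⁆ (subst (_∈ ⁅ y ⁆) y≡z (x∈⁅x⁆ y))))
  where
  ∣xy∣≤2 : ∣ ⁅ x ⁆ ∪ ⁅ y ⁆ ∣ ≤ 2
  ∣xy∣≤2 = ℕ.≤-trans (∣p∪⁅x⁆∣≤1+∣p∣ ⁅ x ⁆ y) (s≤s (ℕ.≤-reflexive (∣⁅x⁆∣≡1 x)))

-- Degrees and edge counts.

true-reflects : ∀ b → Reflects (b ≡ true) b
true-reflects true  = ofʸ refl
true-reflects false = ofⁿ λ ()

-- Built with `because` so that `does` reduces to `adj G u v`: the indicator sums over `adjacent?`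
-- and `edge?` are then `degree` and `e` by computation.
adjacent? : (G : Graph n) → Decidable (Adjacent G)
adjacent? G u v = adj G u v because true-reflects (adj G u v)

Adjacent-sym : (G : Graph n) → ∀ {u v} → Adjacent G u v → Adjacent G v u
Adjacent-sym G {u} {v} uv = trans (symmetric G v u) uv

Adjacent-irrefl : (G : Graph n) → ∀ {u v} → Adjacent G u v → u ≢ v
Adjacent-irrefl G {u} uv refl with () ← trans (sym uv) (irreflexive G u)

edge? : (G : Graph n) → Decidable (λ u v → u Fin.< v × Adjacent G u v)
edge? G u v = u <? v ×-dec adjacent? G u v

e-mono : (G K : Graph n) → (∀ {u v} → Adjacent K u v → Adjacent G u v) → e K ≤ e G
e-mono G K K⊆G = ∑∑-mono λ u v → ⟦⟧-mono (edge? K u v) (edge? G u v) λ (u<v , uv) → u<v , K⊆G uv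

-- A neighbour `w` of `v` is counted in `e` as (v , w) or as (w , v), whichever is increasing;
-- `∑-pick` expands each case to a sum over all pairs, matching the form of `e`.
degree-split : (G : Graph n) (v : Fin n) →
  degree G v ≡ ∑[ u < n ] ∑[ w < n ] ⟦ u ≟ v ×-dec edge? G u w ⟧
             + ∑[ u < n ] ∑[ w < n ] ⟦ w ≟ v ×-dec edge? G u w ⟧
degree-split {n} G v = begin
  degree G v
    ≡⟨ ∑-partition (adjacent? G v) (edge? G v) (λ u → edge? G u v)
         orient (λ _ → proj₂) (λ _ → Adjacent-sym G ∘ proj₂)
         (λ _ (v<w , _) (w<v , _) → ℕ.<-asym v<w w<v) ⟩
  ∑[ w < n ] ⟦ edge? G v w ⟧ + ∑[ u < n ] ⟦ edge? G u v ⟧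
    ≡⟨ cong₂ _+_ (sum-cong-≗ λ w → ∑-pick v (λ u → edge? G u w))
                 (sum-cong-≗ λ u → ∑-pick v (edge? G u)) ⟨
  ∑[ w < n ] ∑[ u < n ] ⟦ u ≟ v ×-dec edge? G u w ⟧
    + ∑[ u < n ] ∑[ w < n ] ⟦ w ≟ v ×-dec edge? G u w ⟧
    ≡⟨ cong (_+ ∑[ u < n ] ∑[ w < n ] ⟦ w ≟ v ×-dec edge? G u w ⟧)
            (∑-comm (λ w u → ⟦ u ≟ v ×-dec edge? G u w ⟧)) ⟩
  ∑[ u < n ] ∑[ w < n ] ⟦ u ≟ v ×-dec edge? G u w ⟧
    + ∑[ u < n ] ∑[ w < n ] ⟦ w ≟ v ×-dec edge? G u w ⟧ ∎
  where
  open ≡-Reasoning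
  orient : ∀ w → Adjacent G v w → (v Fin.< w × Adjacent G v w) ⊎ (w Fin.< v × Adjacent G w v)
  orient w vw with <-cmp v w
  ... | tri< v<w _ _ = inj₁ (v<w , vw)
  ... | tri≈ _ v≡w _ = contradiction v≡w (Adjacent-irrefl G vw)
  ... | tri> _ _ w<v = inj₂ (w<v , Adjacent-sym G vw)

incident? : (G : Graph n) (v : Fin n) →
  Decidable λ u w → (u ≡ v × u Fin.< w × Adjacent G u w) ⊎ (w ≡ v × u Fin.< w × Adjacent G u w)
incident? G v u w = (u ≟ v ×-dec edge? G u w) ⊎-dec (w ≟ v ×-dec edge? G u w)

-- An increasing pair cannot have `v` at both ends, so the two sums of `degree-split` count disjoint
-- sets of edges.
degree≡∑incident : (G : Graph n) (v : Fin n) →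
  degree G v ≡ ∑[ u < n ] ∑[ w < n ] ⟦ incident? G v u w ⟧
degree≡∑incident {n} G v = begin
  degree G v
    ≡⟨ degree-split G v ⟩
  ∑[ u < n ] ∑[ w < n ] ⟦ u ≟ v ×-dec edge? G u w ⟧
    + ∑[ u < n ] ∑[ w < n ] ⟦ w ≟ v ×-dec edge? G u w ⟧
    ≡⟨ ∑∑-distrib-+ (λ u w → ⟦ u ≟ v ×-dec edge? G u w ⟧) (λ u w → ⟦ w ≟ v ×-dec edge? G u w ⟧) ⟨
  ∑[ u < n ] ∑[ w < n ] (⟦ u ≟ v ×-dec edge? G u w ⟧ + ⟦ w ≟ v ×-dec edge? G u w ⟧)
    ≡⟨ sum-cong-≗ (λ u → sum-cong-≗ λ w →
         ⟦⟧-partition (incident? G v u w) (u ≟ v ×-dec edge? G u w) (w ≟ v ×-dec edge? G u w)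
           id inj₁ inj₂ λ { (refl , _) (refl , u<u , _) → ℕ.<-irrefl refl u<u }) ⟨
  ∑[ u < n ] ∑[ w < n ] ⟦ incident? G v u w ⟧ ∎
  where open ≡-Reasoning

-- An edge of `G` either meets `v` or survives in `K`.
e≤degree+e : (G K : Graph n) (v : Fin n) →
  (∀ {u w} → u ≢ v → w ≢ v → Adjacent G u w → Adjacent K u w) → e G ≤ degree G v + e K
e≤degree+e {n} G K v G-v⊆K = begin
  e G
    ≤⟨ ∑∑-mono (λ u w → ⟦⟧-cover (edge? G u w) (incident? G v u w) (edge? K u w) (locate u w)) ⟩
  ∑[ u < n ] ∑[ w < n ] (⟦ incident? G v u w ⟧ + ⟦ edge? K u w ⟧)
    ≡⟨ ∑∑-distrib-+ (λ u w → ⟦ incident? G v u w ⟧) (λ u w → ⟦ edge? K u w ⟧) ⟩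
  ∑[ u < n ] ∑[ w < n ] ⟦ incident? G v u w ⟧ + e K
    ≡⟨ cong (_+ e K) (degree≡∑incident G v) ⟨
  degree G v + e K ∎
  where
  open ℕ.≤-Reasoning
  locate : ∀ u w → u Fin.< w × Adjacent G u w →
    ((u ≡ v × u Fin.< w × Adjacent G u w) ⊎ (w ≡ v × u Fin.< w × Adjacent G u w)) ⊎ (u Fin.< w × Adjacent K u w)
  locate u w edge@(u<w , uw) with u ≟ v | w ≟ v
  ... | yes u≡v | _       = inj₁ (inj₁ (u≡v , edge))
  ... | no _    | yes w≡v = inj₁ (inj₂ (w≡v , edge))
  ... | no u≢v  | no w≢v  = inj₂ (u<w , G-v⊆K u≢v w≢v uw)

-- The edges of `G` at `v` are disjoint from those of `K`, where `v` is isolated.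
degree+e≤e : (G K : Graph n) (v : Fin n) → (∀ {u w} → Adjacent K u w → Adjacent G u w) →
  (∀ {w} → ¬ Adjacent K v w) → degree G v + e K ≤ e G
degree+e≤e {n} G K v K⊆G v-isolated = begin
  degree G v + e K
    ≡⟨ cong (_+ e K) (degree≡∑incident G v) ⟩
  ∑[ u < n ] ∑[ w < n ] ⟦ incident? G v u w ⟧ + e K
    ≡⟨ ∑∑-distrib-+ (λ u w → ⟦ incident? G v u w ⟧) (λ u w → ⟦ edge? K u w ⟧) ⟨
  ∑[ u < n ] ∑[ w < n ] (⟦ incident? G v u w ⟧ + ⟦ edge? K u w ⟧)
    ≤⟨ ∑∑-mono (λ u w → ⟦⟧-pack (edge? G u w) (incident? G v u w) (edge? K u w)
                          [ proj₂ , proj₂ ]′ (λ (u<w , uw) → u<w , K⊆G uw)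
                          [ (λ { (refl , _) (_ , uw) → v-isolated uw })
                          , (λ { (refl , _) (_ , uw) → v-isolated (Adjacent-sym K uw) }) ]′) ⟩
  e G ∎
  where open ℕ.≤-Reasoning

-- Graphs from decidable relations.

does⇒ : (a? : Dec A) → does a? ≡ true → A
does⇒ (yes a) _ = a

module _ {R : Fin n → Fin n → Set} (R? : Decidable R)
         (R-sym : ∀ u v → R u v → R v u) (R-irrefl : ∀ v → ¬ R v v) where

  -- Abstract, so that Adjacent graph u v determines u and v during unification.
  abstract
    graph : Graph n
    graph = record
      { adj         = λ u v → does (R? u v)
      ; symmetric   = λ u v → does-⇔ (mk⇔ (R-sym u v) (R-sym v u)) (R? u v) (R? v u)
      ; irreflexive = λ v → dec-false (R? v v) (R-irrefl v)
      }

    graph⁺ : ∀ {u v} → R u v → Adjacent graph u v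
    graph⁺ {u} {v} = dec-true (R? u v)

    graph⁻ : ∀ {u v} → Adjacent graph u v → R u v
    graph⁻ {u} {v} = does⇒ (R? u v)

-- Induced subgraphs, and the edges needed to connect a vertex set.

restrict : Subset n → Graph n → Graph n
restrict T G = graph (λ u v → adjacent? G u v ×-dec u ∈? T ×-dec v ∈? T)
  (λ u v (uv , u∈ , v∈) → Adjacent-sym G uv , v∈ , u∈) (λ v (vv , _) → Adjacent-irrefl G vv refl)

restrict⁺ : (T : Subset n) (G : Graph n) → ∀ {u v} →
            Adjacent G u v → u ∈ T → v ∈ T → Adjacent (restrict T G) u v
restrict⁺ T G uv u∈ v∈ = graph⁺ _ _ _ (uv , u∈ , v∈)

restrict⁻ : (T : Subset n) (G : Graph n) → ∀ {u v} →
            Adjacent (restrict T G) u v → Adjacent G u v × u ∈ T × v ∈ T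
restrict⁻ T G = graph⁻ _ _ _

-- The first step of the walk that leaves `T` is such an edge.
crossing : (G : Graph n) (T : Subset n) → ∀ {u w} → Star (Adjacent G) u w → u ∈ T → w ∉ T →
           ∃[ a ] ∃[ b ] a ∈ T × b ∉ T × Adjacent G a b
crossing G T ε u∈ u∉ = contradiction u∈ u∉
crossing G T (_◅_ {j = x} ux xw) u∈ w∉ with x ∈? T
... | yes x∈ = crossing G T xw x∈ w∉
... | no  x∉ = _ , _ , u∈ , x∉ , ux

-- `b` is isolated in the graph induced on `T`, and gains at least the edge to `a` once it is added.
restrict-grow : (G : Graph n) (T : Subset n) → ∀ {a b} → a ∈ T → b ∉ T → Adjacent G a b →
                suc (e (restrict T G)) ≤ e (restrict (T ∪ ⁅ b ⁆) G)
restrict-grow {n} G T {a} {b} a∈ b∉ ab = begin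
  suc (e (restrict T G))
    ≤⟨ ℕ.+-monoˡ-≤ (e (restrict T G)) 1≤degree ⟩
  degree (restrict (T ∪ ⁅ b ⁆) G) b + e (restrict T G)
    ≤⟨ degree+e≤e (restrict (T ∪ ⁅ b ⁆) G) (restrict T G) b
         (λ uv → let uv′ , u∈ , v∈ = restrict⁻ T G uv in
                 restrict⁺ (T ∪ ⁅ b ⁆) G uv′ (p⊆p∪q ⁅ b ⁆ u∈) (p⊆p∪q ⁅ b ⁆ v∈))
         (λ bw → b∉ (proj₁ (proj₂ (restrict⁻ T G bw)))) ⟩
  e (restrict (T ∪ ⁅ b ⁆) G) ∎
  where
  open ℕ.≤-Reasoning
  ba : Adjacent (restrict (T ∪ ⁅ b ⁆) G) b a
  ba = restrict⁺ (T ∪ ⁅ b ⁆) G (Adjacent-sym G ab) (q⊆p∪q T ⁅ b ⁆ (x∈⁅x⁆ b)) (p⊆p∪q ⁅ b ⁆ a∈)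
  1≤degree : 1 ≤ degree (restrict (T ∪ ⁅ b ⁆) G) b
  1≤degree = begin
    1 ≡⟨ ∑-≟ a ⟨
    ∑[ w < n ] ⟦ w ≟ a ⟧
      ≤⟨ ∑-mono (λ w → ⟦⟧-mono (w ≟ a) (adjacent? (restrict (T ∪ ⁅ b ⁆) G) b w) λ { refl → ba }) ⟩
    degree (restrict (T ∪ ⁅ b ⁆) G) b ∎

-- Prim's algorithm: as long as T misses a point of W, some edge leaves T.
-- Reachability is only needed up to double negation since the conclusion is decidable.
reachable⇒∣W∣≤1+e : (G : Graph n) (W : Subset n) (r : Fin n) →
  (∀ {w} → w ∈ W → ¬ ¬ Star (Adjacent G) r w) → ∣ W ∣ ≤ suc (e G)
reachable⇒∣W∣≤1+e {n} G W r reach =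
  grow n ⁅ r ⁆ (x∈⁅x⁆ r) (ℕ.m≤m+n n _) (ℕ.≤-trans (ℕ.≤-reflexive (∣⁅x⁆∣≡1 r)) (s≤s z≤n))
  where
  e-restrict≤e : ∀ T → e (restrict T G) ≤ e G
  e-restrict≤e T = e-mono G (restrict T G) (proj₁ ∘ restrict⁻ T G)

  -- `k` bounds the number of vertices still outside `T` and ensures termination; the invariant is
  -- that `T` induces at least |T| - 1 edges.
  grow : ∀ k T → r ∈ T → n ≤ k + ∣ T ∣ → ∣ T ∣ ≤ suc (e (restrict T G)) → ∣ W ∣ ≤ suc (e G)
  grow zero    T r∈ n≤ ∣T∣≤ =
    ℕ.≤-trans (∣p∣≤n W) (ℕ.≤-trans n≤ (ℕ.≤-trans ∣T∣≤ (s≤s (e-restrict≤e T))))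
  grow (suc k) T r∈ n≤ ∣T∣≤ with any? (λ w → w ∈? W ×-dec ¬? (w ∈? T))
  ... | no none = ℕ.≤-trans (p⊆q⇒∣p∣≤∣q∣ W⊆T) (ℕ.≤-trans ∣T∣≤ (s≤s (e-restrict≤e T)))
    where
    W⊆T : W ⊆ T
    W⊆T {w} w∈ = decidable-stable (w ∈? T) λ w∉ → none (w , w∈ , w∉)
  ... | yes (w , w∈ , w∉) = decidable-stable (_ ℕ.≤? _) λ ¬goal → reach w∈ λ path →
    let a , b , a∈ , b∉ , ab = crossing G T path r∈ w∉
        b∈ = q⊆p∪q T ⁅ b ⁆ (x∈⁅x⁆ b)
    in ¬goal $ grow k (T ∪ ⁅ b ⁆) (p⊆p∪q ⁅ b ⁆ r∈)
      (ℕ.≤-trans n≤ (ℕ.≤-trans (ℕ.≤-reflexive (sym (ℕ.+-suc k ∣ T ∣)))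
        (ℕ.+-monoʳ-≤ k (p⊂q⇒∣p∣<∣q∣ (p⊆p∪q ⁅ b ⁆ , b , b∈ , b∉)))))
      (ℕ.≤-trans (∣p∪⁅x⁆∣≤1+∣p∣ T b) (s≤s (ℕ.≤-trans ∣T∣≤ (restrict-grow G T a∈ b∉ ab))))

∣vertices∣≤1+e : {G : Graph n} (H : Subgraph G) → Connected H → ∣ vertices H ∣ ≤ suc (e (edges H))
∣vertices∣≤1+e {n} H conn with nonempty? (vertices H)
... | yes (r , r∈) = reachable⇒∣W∣≤1+e (edges H) (vertices H) r λ w∈ ¬path → ¬path (conn r∈ w∈)
... | no empty rewrite Empty-unique empty | ∣⊥∣≡0 n = z≤n

-- Steiner distances and diameters.

¬¬-minimum : (P : ℕ → Set) → ¬ ¬ (∃[ m ] IsMinimum P m)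
-- If nothing is a minimum, strong induction refutes `P` everywhere, since a value satisfying `P`
-- with none below it would be one. But then infinity is the minimum.
¬¬-minimum P none = none (⊤⁺ , <-rec (λ x → ¬ P x) λ x below Px →
  none ([ x ] , Px , λ y Py → ℕ.≮⇒≥ λ y<x → below y<x Py))

≤⁺-[]⁻ : ∀ {x : ℕ∞} → x ≤⁺ [ d ] → ∃[ m ] x ≡ [ m ] × m ≤ d
≤⁺-[]⁻ [ m≤d ] = _ , refl , m≤d

-- The diameter bounds only those Steiner distances that are given as values; `¬¬-minimum` provides
-- one for `S`, and D ≤ d makes it finite, so some subgraph attains it.
diameter⇒subgraph : (G : Graph n) → ∀ {D} → IsSteinerDiameter k G D → D ≤⁺ [ d ] →
  (S : Subset n) → ∣ S ∣ ≡ k →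
  ¬ ¬ (∃[ H ] (Connected {G = G} H × S ⊆ vertices H × e (edges H) ≤ d))
diameter⇒subgraph G (_ , maximal) D≤d S ∣S∣≡k ¬H = ¬¬-minimum _ λ (x , x-min) →
  impossible (≤⁺-[]⁻ (≤⁺-trans ℕ.≤-trans (maximal x (S , ∣S∣≡k , x-min)) D≤d)) x-min
  where
  impossible : ∀ {x} → ∃[ m ] x ≡ [ m ] × m ≤ _ → ¬ IsSteinerDistance G S x
  impossible (m , refl , m≤d) ((H , conn , S⊆H , refl) , _) = ¬H (H , conn , S⊆H , m≤d)

-- Only the distance of `S` has to be exact; for the other sets a connected subgraph with at most
-- `d` edges bounds the distance and excludes infinity.
steinerDiameter : (G : Graph n) →
  (∀ S → ∣ S ∣ ≡ k → ∃[ H ] (Connected {G = G} H × S ⊆ vertices H × e (edges H) ≤ d)) →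
  (S : Subset n) → ∣ S ∣ ≡ k →
  (∀ H → Connected {G = G} H → S ⊆ vertices H → d ≤ e (edges H)) →
  IsSteinerDiameter k G [ d ]
steinerDiameter {d = d} G upper S ∣S∣≡k lower = (S , ∣S∣≡k , attained) , bounded
  where
  attained : IsSteinerDistance G S [ d ]
  attained with H , conn , S⊆H , e≤d ← upper S ∣S∣≡k =
    (H , conn , S⊆H , ℕ.≤-antisym e≤d (lower H conn S⊆H)) ,
    λ { _ (K , K-conn , S⊆K , refl) → lower K K-conn S⊆K }

  bounded : ∀ x → ∃[ T ] (∣ T ∣ ≡ _ × IsSteinerDistance G T x) → x ≤⁺ [ d ]
  bounded x (T , ∣T∣≡k , x-min) with H , conn , T⊆H , e≤d ← upper T ∣T∣≡k = go x x-min
    where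
    go : ∀ x → IsSteinerDistance G T x → x ≤⁺ [ d ]
    go [ m ] (_ , least) = [ ℕ.≤-trans (least _ (H , conn , T⊆H , refl)) e≤d ]
    go ⊤⁺    none        = ⊥-elim (none _ (H , conn , T⊆H , refl))

-- Maximum degree and the two lower bounds.

Δ≡ : (G : Graph n) (v : Fin n) → degree G v ≡ d → (∀ u → degree G u ≤ d) → Δ G ≡ d
Δ≡ {n} G v refl bound = max≈v⁺ (∈-map⁺ (degree G) (∈-allFin v))
  (All.map⁺ (All.tabulate⁺ bound)) z≤n

Δ-attained : (G : Graph n) → 0 < Δ G → ∃[ v ] degree G v ≡ Δ G
Δ-attained {n} G 0<Δ with argmax-sel id 0 (map (degree G) (allFin n))
-- The maximum may be the default value 0 of `max` rather than a degree; 0 < Δ excludes this.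
... | inj₁ Δ≡0 = contradiction (sym Δ≡0) (ℕ.<⇒≢ 0<Δ)
... | inj₂ Δ∈  = let v , _ , Δ≡degree = ∈-map⁻ (degree G) Δ∈ in v , sym Δ≡degree

-- Vertices 0 and `w` both lie in the complement of a third vertex, which is an `m`-set, and a
-- connected subgraph containing it joins them. Hence `G` is connected.
n≤1+e : (G : Graph (suc m)) → 2 ≤ m → ∀ {D} → IsSteinerDiameter m G D → D ≤⁺ [ d ] → m ≤ e G
n≤1+e {m} G 2≤m diam D≤d = s≤s⁻¹ (ℕ.≤-trans (ℕ.≤-reflexive (sym (∣⊤∣≡n (suc m))))
  (reachable⇒∣W∣≤1+e G ⊤ zero λ {w} _ → reach w))
  where
  reach : ∀ w → ¬ ¬ Star (Adjacent G) zero w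
  reach w ¬path = let x , 0≢x , w≢x = avoid-two (s≤s 2≤m) zero w in
    diameter⇒subgraph G diam D≤d (∁ ⁅ x ⁆) (∣∁⁅x⁆∣≡n x) λ (H , conn , S⊆H , _) →
      ¬path (Star.map (Subgraph.edges-of-G H) (conn (S⊆H (≢⇒∈∁⁅⁆ 0≢x)) (S⊆H (≢⇒∈∁⁅⁆ w≢x))))

-- A connected subgraph with at most m edges has at most m + 1 vertices,
-- so if it contains all vertices but v, it avoids v.
degree+m≤e : (G : Graph (suc (suc m))) (v : Fin (suc (suc m))) (H : Subgraph G) →
             Connected H → ∁ ⁅ v ⁆ ⊆ vertices H → e (edges H) ≤ m → degree G v + m ≤ e G
degree+m≤e {m} G v H conn S⊆H eH≤m = ℕ.≤-trans (ℕ.+-monoʳ-≤ (degree G v) m≤eH)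
  (degree+e≤e G (edges H) v (Subgraph.edges-of-G H) (v∉H ∘ proj₁ ∘ Subgraph.edges-within H))
  where
  open ℕ.≤-Reasoning
  v∉H : v ∉ vertices H
  v∉H v∈H = ℕ.<-irrefl refl $ begin-strict
    suc m                ≡⟨ ∣∁⁅x⁆∣≡n v ⟨
    ∣ ∁ ⁅ v ⁆ ∣          <⟨ p⊂q⇒∣p∣<∣q∣ (S⊆H , v , v∈H , λ v∈S → ∈∁⁅⁆⇒≢ v∈S refl) ⟩
    ∣ vertices H ∣       ≤⟨ ∣vertices∣≤1+e H conn ⟩
    suc (e (edges H))    ≤⟨ s≤s eH≤m ⟩
    suc m                ∎
  m≤eH : m ≤ e (edges H)
  m≤eH = s≤s⁻¹ $ begin
    suc m                ≡⟨ ∣∁⁅x⁆∣≡n v ⟨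
    ∣ ∁ ⁅ v ⁆ ∣          ≤⟨ p⊆q⇒∣p∣≤∣q∣ S⊆H ⟩
    ∣ vertices H ∣       ≤⟨ ∣vertices∣≤1+e H conn ⟩
    suc (e (edges H))    ∎

-- The set omitting a vertex of maximum degree lies in a connected subgraph with at most `m` edges.
-- The inequality is decidable, so existence up to double negation is enough.
Δ+m≤e : (G : Graph (suc (suc m))) → 0 < Δ G → ∀ {D} →
        IsSteinerDiameter (suc m) G D → D ≤⁺ [ m ] → Δ G + m ≤ e G
Δ+m≤e {m} G 0<Δ diam D≤m =
  let v , degree≡Δ = Δ-attained G 0<Δ in
  subst (λ x → x + m ≤ e G) degree≡Δ $ decidable-stable (_ ℕ.≤? _) λ ¬goal →
  diameter⇒subgraph G diam D≤m (∁ ⁅ v ⁆) (∣∁⁅x⁆∣≡n v) λ (H , conn , S⊆H , eH≤m) →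
  ¬goal (degree+m≤e G v H conn S⊆H eH≤m)

-- Graphs underlying directed relations.

module _ {D : Fin n → Fin n → Set} (D? : Decidable D) where

  -- Loops are discarded here, so `D` may contain some, as `Arc` below does at 0.
  symmetrise : Graph n
  symmetrise = graph (λ u v → ¬? (u ≟ v) ×-dec (D? u v ⊎-dec D? v u))
    (λ u v (u≢v , uv) → ≢-sym u≢v , Sum.swap uv) (λ v (v≢v , _) → v≢v refl)

  symmetrise⁺ : ∀ {u v} → u ≢ v → D u v → Adjacent symmetrise u v
  symmetrise⁺ u≢v uv = graph⁺ _ _ _ (u≢v , inj₁ uv)

  symmetrise⁻ : ∀ {u v} → Adjacent symmetrise u v → D u v ⊎ D v u
  symmetrise⁻ = proj₂ ∘ graph⁻ _ _ _

  -- Each edge is charged to an arc that produces it. Swapping the summation indices makes the edges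
  -- charged to descending arcs range over pairs with v < u, disjoint from the ascending ones.
  e-symmetrise≤ : e symmetrise ≤ ∑[ u < n ] ∑[ v < n ] ⟦ D? u v ⟧
  e-symmetrise≤ = begin
    e symmetrise
      ≤⟨ ∑∑-mono (λ u v → ⟦⟧-cover (edge? symmetrise u v) (forward? u v) (backward? v u) λ (u<v , uv) →
           Sum.map (u<v ,_) (u<v ,_) (symmetrise⁻ uv)) ⟩
    ∑[ u < n ] ∑[ v < n ] (⟦ forward? u v ⟧ + ⟦ backward? v u ⟧)
      ≡⟨ ∑∑-distrib-+ (λ u v → ⟦ forward? u v ⟧) (λ u v → ⟦ backward? v u ⟧) ⟩
    ∑[ u < n ] ∑[ v < n ] ⟦ forward? u v ⟧ + ∑[ u < n ] ∑[ v < n ] ⟦ backward? v u ⟧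
      ≡⟨ cong (∑[ u < n ] ∑[ v < n ] ⟦ forward? u v ⟧ +_) (∑-comm (λ u v → ⟦ backward? v u ⟧)) ⟩
    ∑[ u < n ] ∑[ v < n ] ⟦ forward? u v ⟧ + ∑[ u < n ] ∑[ v < n ] ⟦ backward? u v ⟧
      ≡⟨ ∑∑-distrib-+ (λ u v → ⟦ forward? u v ⟧) (λ u v → ⟦ backward? u v ⟧) ⟨
    ∑[ u < n ] ∑[ v < n ] (⟦ forward? u v ⟧ + ⟦ backward? u v ⟧)
      ≤⟨ ∑∑-mono (λ u v → ⟦⟧-pack (D? u v) (forward? u v) (backward? u v) proj₂ proj₂
           λ (u<v , _) (v<u , _) → ℕ.<-asym u<v v<u) ⟩
    ∑[ u < n ] ∑[ v < n ] ⟦ D? u v ⟧ ∎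
    where
    open ℕ.≤-Reasoning
    forward? : Decidable λ u v → u Fin.< v × D u v
    forward? u v = u <? v ×-dec D? u v
    backward? : Decidable λ u v → v Fin.< u × D u v
    backward? u v = v <? u ×-dec D? u v

module _ (f : Fin n → Fin n) {Q : Fin n → Set} (Q? : ∀ u → Dec (Q u)) where

  -- Covers both the parent map of a tree and the predecessor map of a cycle; `Q` selects the
  -- vertices that keep their outgoing arc.
  functional : Graph n
  functional = symmetrise (λ u v → v ≟ f u ×-dec Q? u)

  functional⁺ : ∀ {u} → u ≢ f u → Q u → Adjacent functional u (f u)
  functional⁺ u≢fu Qu = symmetrise⁺ (λ u v → v ≟ f u ×-dec Q? u) u≢fu (refl , Qu)

  functional⁻ : ∀ {u v} → Adjacent functional u v → (v ≡ f u × Q u) ⊎ (u ≡ f v × Q v)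
  functional⁻ = symmetrise⁻ (λ u v → v ≟ f u ×-dec Q? u)

  e-functional≤ : e functional ≤ ∑[ u < n ] ⟦ Q? u ⟧
  e-functional≤ = ℕ.≤-trans (e-symmetrise≤ (λ u v → v ≟ f u ×-dec Q? u))
    (ℕ.≤-reflexive (sum-cong-≗ λ u → ∑-pick (f u) (λ _ → Q? u)))

∑-unique : {P : Fin n → Set} (P? : ∀ i → Dec (P i)) → (∀ {i j} → P i → P j → i ≡ j) →
           ∑[ i < n ] ⟦ P? i ⟧ ≤ 1
∑-unique P? unique with any? P?
... | yes (x , Px) = ℕ.≤-trans (∑-mono λ i → ⟦⟧-mono (P? i) (i ≟ x) λ Pi → unique Pi Px)
                               (ℕ.≤-reflexive (∑-≟ x))
... | no none      = ℕ.≤-trans (ℕ.≤-reflexive (∑-zero λ i → ⟦⟧-false (P? i) λ Pi → none (i , Pi))) z≤n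

rooted : (G : Graph n) (W : Subset n) (r : Fin n) → (∀ {u} → u ∈ W → Star (Adjacent G) u r) →
         ∀ {u v} → u ∈ W → v ∈ W → Star (Adjacent G) u v
rooted G W r path u∈ v∈ = path u∈ ◅◅ Star.reverse (Adjacent-sym G) (path v∈)

whole : (G : Graph n) → Subgraph G
whole G = record { vertices = ⊤ ; edges = G ; edges-of-G = id ; edges-within = λ _ → ∈⊤ , ∈⊤ }

-- The broom, extremal for the first claim.

-- A star with ℓ leaves, one of which is extended by a path.
module Broom (m ℓ : ℕ) (2≤ℓ : 2 ≤ ℓ) (ℓ≤m : ℓ ≤ suc (suc m)) where

  private
    N : ℕ
    N = suc (suc (suc m))

  -- Vertices 1, ..., ℓ hang from the centre 0 and every later vertex from its predecessor, so the
  -- path extends vertex ℓ. The arc from the root to itself is removed by `nonroot?`.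
  parent : Fin N → Fin N
  parent zero    = zero
  parent (suc i) = if does (toℕ i ℕ.<? ℓ) then zero else inject₁ i

  parent-suc : ∀ i → (toℕ i < ℓ × parent (suc i) ≡ zero) ⊎ (ℓ ≤ toℕ i × parent (suc i) ≡ inject₁ i)
  parent-suc i with toℕ i ℕ.<? ℓ
  ... | yes i<ℓ = inj₁ (i<ℓ , cong (if_then zero else inject₁ i) (dec-true (toℕ i ℕ.<? ℓ) i<ℓ))
  ... | no  i≮ℓ = inj₂ (ℕ.≮⇒≥ i≮ℓ , cong (if_then zero else inject₁ i) (dec-false (toℕ i ℕ.<? ℓ) i≮ℓ))

  parent≤ : ∀ i → toℕ (parent (suc i)) ≤ toℕ i
  parent≤ i with parent-suc i
  ... | inj₁ (_ , eq) rewrite eq = z≤n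
  ... | inj₂ (_ , eq) rewrite eq = ℕ.≤-reflexive (toℕ-inject₁ i)

  nonroot? : (u : Fin N) → Dec (u ≢ zero)
  nonroot? u = ¬? (u ≟ zero)

  broom : Graph N
  broom = functional parent nonroot?

  e-broom≤ : e broom ≤ suc (suc m)
  e-broom≤ = ℕ.≤-trans (e-functional≤ parent nonroot?) (ℕ.≤-reflexive (∑-one {suc (suc m)} λ _ → refl))

  parent-edge : ∀ i → Adjacent broom (suc i) (parent (suc i))
  parent-edge i = functional⁺ parent nonroot?
    (λ eq → ℕ.<-irrefl (cong toℕ (sym eq)) (s≤s (parent≤ i))) λ ()

  -- Only the path rule yields a parent other than the centre.
  child : ∀ {u w} → u ≢ zero → u ≡ parent w → toℕ w ≡ suc (toℕ u) × ℓ ≤ toℕ u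
  child {w = zero}  u≢0 u≡0 = contradiction u≡0 u≢0
  child {w = suc i} u≢0 refl with parent-suc i
  ... | inj₁ (_ , eq)   = contradiction eq u≢0
  ... | inj₂ (ℓ≤i , eq) rewrite eq | toℕ-inject₁ i = refl , ℓ≤i

  -- The closed neighbourhood of the centre is the initial segment 0, ..., ℓ; the 1 added to both
  -- sides counts the centre itself.
  degree-zero : degree broom zero ≡ ℓ
  degree-zero = ℕ.+-cancelʳ-≡ 1 _ _ $ begin
    degree broom zero + 1
      ≡⟨ cong (degree broom zero +_) (∑-≟ {N} zero) ⟨
    degree broom zero + ∑[ w < N ] ⟦ w ≟ zero ⟧
      ≡⟨ ∑-partition (λ w → toℕ w ℕ.<? suc ℓ) (adjacent? broom zero) (_≟ zero) near close
           (λ { _ refl → z<s }) (λ w edge → Adjacent-irrefl broom edge ∘ sym) ⟨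
    ∑[ w < N ] ⟦ toℕ w ℕ.<? suc ℓ ⟧
      ≡⟨ ∑-<? (suc ℓ) (s≤s ℓ≤m) ⟩
    suc ℓ
      ≡⟨ ℕ.+-comm 1 ℓ ⟩
    ℓ + 1 ∎
    where
    open ≡-Reasoning
    near : ∀ w → toℕ w < suc ℓ → Adjacent broom zero w ⊎ w ≡ zero
    near zero    _   = inj₂ refl
    near (suc i) i<ℓ with parent-suc i | parent-edge i
    ... | inj₁ (_ , eq)   | edge = inj₁ (Adjacent-sym broom (subst (Adjacent broom (suc i)) eq edge))
    ... | inj₂ (ℓ≤i , _)  | _    = contradiction (s<s⁻¹ i<ℓ) (ℕ.≤⇒≯ ℓ≤i)
    close : ∀ w → Adjacent broom zero w → toℕ w < suc ℓ
    close zero    _    = z<s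
    close (suc i) edge with functional⁻ parent nonroot? edge | parent-suc i
    ... | inj₁ (_ , 0≢0) | _                = contradiction refl 0≢0
    ... | inj₂ _         | inj₁ (i<ℓ , _)   = s≤s i<ℓ
    ... | inj₂ (eq , _)  | inj₂ (ℓ≤i , eq′) = contradiction
      (trans (sym (toℕ-inject₁ i)) (cong toℕ (sym (trans eq eq′))))
      (ℕ.>⇒≢ (ℕ.≤-trans (s≤s z≤n) (ℕ.≤-trans 2≤ℓ ℓ≤i)))

  -- Apart from the centre, a vertex has one parent and at most one child, its successor, and 2 ≤ ℓ.
  degree≤ℓ : ∀ u → degree broom u ≤ ℓ
  degree≤ℓ zero      = ℕ.≤-reflexive degree-zero
  degree≤ℓ u@(suc _) = ℕ.≤-trans
    (∑-cover (adjacent? broom u) (_≟ parent u) (λ w → toℕ w ℕ.≟ suc (toℕ u)) λ w edge →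
      Sum.map proj₁ (λ (eq , _) → proj₁ (child {u} {w} (λ ()) eq)) (functional⁻ parent nonroot? edge))
    (ℕ.≤-trans (ℕ.+-mono-≤ (ℕ.≤-reflexive (∑-≟ (parent u)))
      (∑-unique {N} (λ w → toℕ w ℕ.≟ suc (toℕ u)) λ eq eq′ → toℕ-injective (trans eq (sym eq′)))) 2≤ℓ)

  Δ-broom : Δ broom ≡ ℓ
  Δ-broom = Δ≡ broom zero degree-zero degree≤ℓ

  to-zero : ∀ u → Star (Adjacent broom) u zero
  to-zero = <-weakInduction (λ u → Star (Adjacent broom) u zero) ε step
    where
    step : ∀ i → Star (Adjacent broom) (inject₁ i) zero → Star (Adjacent broom) (suc i) zero
    step i path with parent-suc i | parent-edge i
    ... | inj₁ (_ , eq) | edge = subst (Adjacent broom (suc i)) eq edge ◅ ε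
    ... | inj₂ (_ , eq) | edge = subst (Adjacent broom (suc i)) eq edge ◅ path

  connected : Connected (whole broom)
  connected = rooted broom ⊤ zero λ {u} _ → to-zero u

  -- A child of vertex 1 would force ℓ ≤ 1.
  leaf : ∀ {w} → Adjacent broom (suc zero) w → w ≡ zero
  leaf {w} edge with functional⁻ parent nonroot? edge | parent-suc zero
  ... | inj₁ (w≡ , _) | inj₁ (_ , eq)  = trans w≡ eq
  ... | inj₁ _        | inj₂ (ℓ≤0 , _) = contradiction (ℕ.≤-trans 2≤ℓ ℓ≤0) λ ()
  ... | inj₂ (eq , _) | _              =
    contradiction (ℕ.≤-trans 2≤ℓ (proj₂ (child {w = w} (λ ()) eq))) λ { (s≤s ()) }

  -- Without the centre there is no way out of the leaf 1.
  lower : ∀ H → Connected {G = broom} H → ∁ ⁅ zero ⁆ ⊆ vertices H → suc (suc m) ≤ e (edges H)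
  lower H conn S⊆H = s≤s⁻¹ $ ℕ.≤-trans (ℕ.≤-reflexive (sym (∣⊤∣≡n N))) $
    ℕ.≤-trans (p⊆q⇒∣p∣≤∣q∣ {p = ⊤} {q = vertices H} λ {u} _ → all u) (∣vertices∣≤1+e H conn)
    where
    centre∈ : Star (Adjacent (edges H)) (suc zero) (suc (suc zero)) → zero ∈ vertices H
    centre∈ (1x ◅ _) =
      subst (_∈ vertices H) (leaf (Subgraph.edges-of-G H 1x)) (proj₂ (Subgraph.edges-within H 1x))
    all : ∀ u → u ∈ vertices H
    all zero    = centre∈ (conn (S⊆H (≢⇒∈∁⁅⁆ {y = zero} λ ())) (S⊆H (≢⇒∈∁⁅⁆ {y = zero} λ ())))
    all (suc i) = S⊆H (≢⇒∈∁⁅⁆ {y = zero} λ ())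

  diameter : IsSteinerDiameter (suc (suc m)) broom [ suc (suc m) ]
  diameter = steinerDiameter broom (λ S _ → whole broom , connected , ⊆⊤ , e-broom≤)
    (∁ ⁅ zero ⁆) (∣∁⁅x⁆∣≡n {suc (suc m)} zero) lower

  minimum-size : IsMinimumSize (suc (suc m)) (suc (suc (suc m))) ℓ (suc (suc m)) [ suc (suc m) ]
  minimum-size = (broom , broom∈ℋ , ℕ.≤-antisym e-broom≤ (bound broom broom∈ℋ)) ,
    λ x (G , G∈ℋ , eG≡x) → subst (suc (suc m) ≤_) eG≡x (bound G G∈ℋ)
    where
    broom∈ℋ : ℋ (suc (suc m)) N ℓ (suc (suc m)) broom
    broom∈ℋ = Δ-broom , [ suc (suc m) ] , diameter , [ ℕ.≤-refl ]
    bound : ∀ G → ℋ (suc (suc m)) N ℓ (suc (suc m)) G → suc (suc m) ≤ e G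
    bound G (_ , D , diam , D≤) = n≤1+e G (s≤s (s≤s z≤n)) diam D≤

-- The cycle as a predecessor map, and the paths left by deleting a vertex.

prev : Fin (suc n) → Fin (suc n)
prev zero    = fromℕ _
prev (suc i) = inject₁ i

prev-injective : {i j : Fin (suc n)} → prev i ≡ prev j → i ≡ j
prev-injective {i = zero}  {zero}  _  = refl
prev-injective {i = zero}  {suc j} eq = contradiction eq fromℕ≢inject₁
prev-injective {i = suc i} {zero}  eq = contradiction (sym eq) fromℕ≢inject₁
prev-injective {i = suc i} {suc j} eq = cong suc (inject₁-injective eq)

prev-surjective : (i : Fin (suc n)) → ∃[ j ] prev j ≡ i
prev-surjective i with view i
... | ‵fromℕ     = zero , refl
... | ‵inject₁ j = suc j , refl

prev≢ : (i : Fin (suc (suc n))) → i ≢ prev i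
prev≢ zero    ()
prev≢ (suc i) eq = ℕ.1+n≢n (trans (cong toℕ eq) (toℕ-inject₁ i))

module Cycle (m : ℕ) where

  private
    N : ℕ
    N = suc (suc m)

  -- Cycle edges are indexed by `u`, standing for the edge from `u` to `prev u`; the condition is
  -- that neither end is `i`.
  Avoids : Fin N → Fin N → Set
  Avoids i u = u ≢ i × prev u ≢ i

  avoids? : ∀ i u → Dec (Avoids i u)
  avoids? i u = ¬? (u ≟ i) ×-dec ¬? (prev u ≟ i)

  cycle-minus : Fin N → Graph N
  cycle-minus i = functional prev (avoids? i)

  -- The two deleted edges are those from i to prev i and from the successor of i to i.
  e-cycle-minus≤ : ∀ i → e (cycle-minus i) ≤ m
  e-cycle-minus≤ i = ℕ.≤-trans (e-functional≤ prev (avoids? i)) $ ℕ.+-cancelʳ-≤ 2 _ _ $ begin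
    ∑[ u < N ] ⟦ avoids? i u ⟧ + 2
      ≡⟨ ℕ.+-assoc _ 1 1 ⟨
    ∑[ u < N ] ⟦ avoids? i u ⟧ + 1 + 1
      ≡⟨ cong₂ (λ a b → ∑[ u < N ] ⟦ avoids? i u ⟧ + a + b) (∑-≟ j) (∑-≟ i) ⟨
    ∑[ u < N ] ⟦ avoids? i u ⟧ + ∑[ u < N ] ⟦ u ≟ j ⟧ + ∑[ u < N ] ⟦ u ≟ i ⟧
      ≤⟨ ℕ.+-monoˡ-≤ _ (∑-pack (λ u → ¬? (u ≟ i)) (avoids? i) (_≟ j)
           (λ _ → proj₁) (λ { _ refl j≡i → prev≢ j (trans j≡i (sym prev-j)) })
           (λ { _ (_ , prev-u≢i) refl → prev-u≢i prev-j })) ⟩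
    ∑[ u < N ] ⟦ ¬? (u ≟ i) ⟧ + ∑[ u < N ] ⟦ u ≟ i ⟧
      ≤⟨ ∑-pack (λ u → ⊤-dec) (λ u → ¬? (u ≟ i)) (_≟ i) _ _ (λ _ → id) ⟩
    ∑[ u < N ] 1
      ≡⟨ ∑-one {N} (λ _ → refl) ⟩
    N
      ≡⟨ ℕ.+-comm 2 m ⟩
    m + 2 ∎
    where
    open ℕ.≤-Reasoning
    j = proj₁ (prev-surjective i)
    prev-j = proj₂ (prev-surjective i)

  private
    Path : Fin N → Fin N → Fin N → Set
    Path i = Star (Adjacent (cycle-minus i))

  link : ∀ i {u} → u ≢ i → prev u ≢ i → Adjacent (cycle-minus i) u (prev u)
  link i {u} u≢i prev-u≢i = functional⁺ prev (avoids? i) (prev≢ u) (u≢i , prev-u≢i)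

  upwards : ∀ i u → i Fin.< u → Path i u (fromℕ _)
  upwards i = >-weakInduction (λ u → i Fin.< u → Path i u (fromℕ _)) (λ _ → ε) λ k path i<k →
    let i<1+k = ℕ.≤-trans i<k (ℕ.≤-trans (ℕ.≤-reflexive (toℕ-inject₁ k)) (ℕ.n≤1+n _))
    in Adjacent-sym (cycle-minus i) (link i {suc k} (≢-sym (<⇒≢ i<1+k)) (≢-sym (<⇒≢ i<k))) ◅ path i<1+k

  downwards : ∀ i u → u Fin.< i → Path i u zero
  downwards i = <-weakInduction (λ u → u Fin.< i → Path i u zero) (λ _ → ε) λ k path 1+k<i →
    let k<i = ℕ.≤-trans (s≤s (ℕ.≤-trans (ℕ.≤-reflexive (toℕ-inject₁ k)) (ℕ.n≤1+n _))) 1+k<i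
    in link i {suc k} (<⇒≢ 1+k<i) (<⇒≢ k<i) ◅ path k<i

  -- Deleting `i` leaves the segments above and below it, which the edge between the last vertex and
  -- 0 joins. For `i` = 0 only the upper segment remains, so the last vertex is the root.
  root : ∀ i → ∃[ r ] (∀ {u} → u ∈ ∁ ⁅ i ⁆ → Path i u r)
  root zero      = fromℕ _ , λ {u} u∈ → upwards zero u (ℕ.n≢0⇒n>0 (∈∁⁅⁆⇒≢ u∈ ∘ toℕ-injective))
  root i@(suc _) = zero , λ {u} u∈ → path u (∈∁⁅⁆⇒≢ u∈)
    where
    path : ∀ u → u ≢ i → Path i u zero
    path u u≢i with <-cmp u i
    ... | tri< u<i _ _ = downwards i u u<i
    ... | tri≈ _ u≡i _ = contradiction u≡i u≢i
    ... | tri> _ _ i<u = upwards i u i<u ◅◅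
      (Adjacent-sym (cycle-minus i) (link i {zero} (λ ()) (≢-sym (<⇒≢ (ℕ.≤-trans i<u (≤fromℕ u))))) ◅ ε)

  cycle-minus-edge : ∀ i {u v} → Adjacent (cycle-minus i) u v →
                     u ≢ v × (v ≡ prev u ⊎ u ≡ prev v) × u ≢ i × v ≢ i
  cycle-minus-edge i {u} {v} uv = Adjacent-irrefl (cycle-minus i) uv , case (functional⁻ prev (avoids? i) uv)
    where
    case : (v ≡ prev u × Avoids i u) ⊎ (u ≡ prev v × Avoids i v) → (v ≡ prev u ⊎ u ≡ prev v) × u ≢ i × v ≢ i
    case (inj₁ (refl , u≢i , v≢i)) = inj₁ refl , u≢i , v≢i
    case (inj₂ (refl , v≢i , u≢i)) = inj₂ refl , u≢i , v≢i

-- The fan, extremal for the second claim.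

-- The cycle 0, 1, …, m + 1 with chords from 0, which make the degree of 0 equal to ℓ.
module Fan (m ℓ : ℕ) (2≤ℓ : 2 ≤ ℓ) (ℓ≤m : ℓ ≤ suc m) where

  open Cycle m

  private
    N : ℕ
    N = suc (suc m)

  -- The second alternative gives only a loop at vertex 0 and a cycle edge at vertex 1, so the new
  -- chords go to 2, ..., ℓ - 1.
  Arc : Fin N → Fin N → Set
  Arc u v = v ≡ prev u ⊎ (v ≡ zero × toℕ u < ℓ)

  arc? : Decidable Arc
  arc? u v = v ≟ prev u ⊎-dec (v ≟ zero ×-dec toℕ u ℕ.<? ℓ)

  fan : Graph N
  fan = symmetrise arc?

  -- The closed neighbourhood of 0 consists of 0, ..., ℓ - 1 and the last vertex m + 1, which is not
  -- below ℓ because ℓ ≤ m + 1.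
  degree-zero : degree fan zero ≡ ℓ
  degree-zero = ℕ.+-cancelʳ-≡ 1 _ _ $ begin
    degree fan zero + 1
      ≡⟨ cong (degree fan zero +_) (∑-≟ {N} zero) ⟨
    degree fan zero + ∑[ w < N ] ⟦ w ≟ zero ⟧
      ≡⟨ ∑-partition near? (adjacent? fan zero) (_≟ zero) join near
           (λ { _ refl → inj₁ (ℕ.≤-trans (s≤s z≤n) 2≤ℓ) })
           (λ w edge → Adjacent-irrefl fan edge ∘ sym) ⟨
    ∑[ w < N ] ⟦ near? w ⟧
      ≡⟨ ∑-partition near? (λ w → toℕ w ℕ.<? ℓ) (_≟ fromℕ _) (λ _ → id) (λ _ → inj₁) (λ _ → inj₂)
           (λ { _ last<ℓ refl → ℕ.<⇒≱ (subst (_< ℓ) (toℕ-fromℕ _) last<ℓ) ℓ≤m }) ⟩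
    ∑[ w < N ] ⟦ toℕ w ℕ.<? ℓ ⟧ + ∑[ w < N ] ⟦ w ≟ fromℕ _ ⟧
      ≡⟨ cong₂ _+_ (∑-<? {N} ℓ (ℕ.m≤n⇒m≤1+n ℓ≤m)) (∑-≟ {N} (fromℕ _)) ⟩
    ℓ + 1 ∎
    where
    open ≡-Reasoning
    near? : (w : Fin N) → Dec (toℕ w < ℓ ⊎ w ≡ fromℕ _)
    near? w = toℕ w ℕ.<? ℓ ⊎-dec w ≟ fromℕ _
    join : (w : Fin N) → toℕ w < ℓ ⊎ w ≡ fromℕ _ → Adjacent fan zero w ⊎ w ≡ zero
    join zero    _          = inj₂ refl
    join (suc i) (inj₁ w<ℓ) =
      inj₁ (Adjacent-sym fan (symmetrise⁺ arc? (λ ()) (inj₂ (refl , w<ℓ))))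
    join (suc i) (inj₂ eq)  = inj₁ (symmetrise⁺ arc? (λ ()) (inj₁ eq))
    near : (w : Fin N) → Adjacent fan zero w → toℕ w < ℓ ⊎ w ≡ fromℕ _
    near zero    _    = inj₁ (ℕ.≤-trans (s≤s z≤n) 2≤ℓ)
    near (suc i) edge with symmetrise⁻ arc? edge
    ... | inj₁ (inj₁ eq)        = inj₂ eq
    ... | inj₂ (inj₁ eq)        =
      inj₁ (subst (λ x → suc x < ℓ) (trans (cong toℕ eq) (toℕ-inject₁ i)) 2≤ℓ)
    ... | inj₂ (inj₂ (_ , w<ℓ)) = inj₁ w<ℓ

  -- Besides its two cycle neighbours, a vertex `u` other than 0 can only have a chord to 0. At
  -- vertex 1 this is a cycle edge, and for u ≥ 2 it requires u < ℓ, so a third neighbour occurs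
  -- only if ℓ ≥ 3.
  degree≤ℓ : ∀ u → degree fan u ≤ ℓ
  degree≤ℓ zero      = ℕ.≤-reflexive degree-zero
  degree≤ℓ u@(suc i) = begin
    degree fan u
      ≤⟨ ∑-cover (adjacent? fan u) (_≟ prev u) other? (neighbours i) ⟩
    ∑[ w < N ] ⟦ w ≟ prev u ⟧ + ∑[ w < N ] ⟦ other? w ⟧
      ≤⟨ ℕ.+-mono-≤ (ℕ.≤-reflexive (∑-≟ (prev u)))
           (∑-cover other? (λ w → u ≟ prev w) (λ w → w ≟ zero ×-dec 2 ℕ.<? ℓ) λ _ → id) ⟩
    1 + (∑[ w < N ] ⟦ u ≟ prev w ⟧ + ∑[ w < N ] ⟦ w ≟ zero ×-dec 2 ℕ.<? ℓ ⟧)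
      ≤⟨ s≤s (ℕ.+-mono-≤
           (∑-unique {N} (λ w → u ≟ prev w) λ eq eq′ → prev-injective (trans (sym eq) eq′))
           (ℕ.≤-reflexive (∑-pick {N} zero (λ _ → 2 ℕ.<? ℓ)))) ⟩
    2 + ⟦ 2 ℕ.<? ℓ ⟧
      ≤⟨ third (2 ℕ.<? ℓ) ⟩
    ℓ ∎
    where
    open ℕ.≤-Reasoning
    other? : (w : Fin N) → Dec (u ≡ prev w ⊎ (w ≡ zero × 2 < ℓ))
    other? w = u ≟ prev w ⊎-dec (w ≟ zero ×-dec 2 ℕ.<? ℓ)
    third : (2<ℓ? : Dec (2 < ℓ)) → 2 + ⟦ 2<ℓ? ⟧ ≤ ℓ
    third (yes 2<ℓ) = 2<ℓ
    third (no _)    = 2≤ℓ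
    neighbours : ∀ i w → Adjacent fan (suc i) w →
                 w ≡ prev (suc i) ⊎ (suc i ≡ prev w ⊎ (w ≡ zero × 2 < ℓ))
    neighbours i w edge with symmetrise⁻ arc? edge
    ... | inj₁ (inj₁ w≡prev)      = inj₁ w≡prev
    ... | inj₂ (inj₁ u≡prev)      = inj₂ (inj₁ u≡prev)
    neighbours zero    w edge | inj₁ (inj₂ (w≡0 , _))   = inj₁ w≡0
    neighbours (suc i) w edge | inj₁ (inj₂ (w≡0 , u<ℓ)) =
      inj₂ (inj₂ (w≡0 , ℕ.≤-trans (s≤s (s≤s (s≤s z≤n))) u<ℓ))

  Δ-fan : Δ fan ≡ ℓ
  Δ-fan = Δ≡ fan zero degree-zero degree≤ℓ

  cycle-minus⊆fan : ∀ i {u v} → Adjacent (cycle-minus i) u v → Adjacent fan u v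
  cycle-minus⊆fan i {u} {v} uv with cycle-minus-edge i {u} {v} uv
  ... | u≢v , inj₁ v≡prev , _ = symmetrise⁺ arc? u≢v (inj₁ v≡prev)
  ... | u≢v , inj₂ u≡prev , _ =
    Adjacent-sym fan (symmetrise⁺ arc? (≢-sym u≢v) (inj₁ u≡prev))

  -- Deleting 0 removes ℓ edges, among them every chord, and leaves a path with at most `m` edges.
  e-fan≤ : e fan ≤ ℓ + m
  e-fan≤ = ℕ.≤-trans (e≤degree+e fan (cycle-minus zero) zero off-centre)
    (ℕ.+-mono-≤ (ℕ.≤-reflexive degree-zero) (e-cycle-minus≤ zero))
    where
    off-centre : ∀ {u w} → u ≢ zero → w ≢ zero → Adjacent fan u w → Adjacent (cycle-minus zero) u w
    off-centre {u} {w} u≢0 w≢0 uw with symmetrise⁻ arc? uw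
    ... | inj₁ (inj₁ refl)      = link zero {u} u≢0 w≢0
    ... | inj₁ (inj₂ (w≡0 , _)) = contradiction w≡0 w≢0
    ... | inj₂ (inj₁ refl)      = Adjacent-sym (cycle-minus zero) (link zero {w} w≢0 u≢0)
    ... | inj₂ (inj₂ (u≡0 , _)) = contradiction u≡0 u≢0

  avoiding : Fin N → Subgraph fan
  avoiding i = record
    { vertices     = ∁ ⁅ i ⁆
    ; edges        = cycle-minus i
    ; edges-of-G   = λ {u} {v} → cycle-minus⊆fan i {u} {v}
    ; edges-within = λ {u} {v} uv → let _ , _ , u≢i , v≢i = cycle-minus-edge i {u} {v} uv
                                    in ≢⇒∈∁⁅⁆ u≢i , ≢⇒∈∁⁅⁆ v≢i
    }

  diameter : IsSteinerDiameter (suc m) fan [ m ]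
  diameter = steinerDiameter fan upper (∁ ⁅ zero ⁆) ∣S∣ lower
    where
    ∣S∣ : ∣ ∁ ⁅ zero {suc m} ⁆ ∣ ≡ suc m
    ∣S∣ = ∣∁⁅x⁆∣≡n {suc m} zero
    upper : ∀ S → ∣ S ∣ ≡ suc m →
            ∃[ H ] (Connected {G = fan} H × S ⊆ vertices H × e (edges H) ≤ m)
    upper S ∣S∣≡ =
      -- A set of m + 1 vertices omits some `i`, and the cycle without `i` is a path through all the
      -- others.
      let i , i∉S = ∣p∣<n⇒∃∉ S (s≤s (ℕ.≤-reflexive ∣S∣≡))
          r , path = root i
      in avoiding i , rooted (cycle-minus i) (∁ ⁅ i ⁆) r path ,
         (λ x∈S → ≢⇒∈∁⁅⁆ λ x≡i → i∉S (subst (_∈ S) x≡i x∈S)) , e-cycle-minus≤ i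
    lower : ∀ H → Connected {G = fan} H → ∁ ⁅ zero ⁆ ⊆ vertices H → m ≤ e (edges H)
    lower H conn S⊆H = s≤s⁻¹ $ ℕ.≤-trans (ℕ.≤-reflexive (sym ∣S∣)) $
      ℕ.≤-trans (p⊆q⇒∣p∣≤∣q∣ S⊆H) (∣vertices∣≤1+e H conn)

  minimum-size : IsMinimumSize (suc m) (suc (suc m)) ℓ m [ m + ℓ ]
  minimum-size = (fan , fan∈ℋ , ℕ.≤-antisym e-fan≤m+ℓ (bound fan fan∈ℋ)) ,
    λ x (G , G∈ℋ , eG≡x) → subst (m + ℓ ≤_) eG≡x (bound G G∈ℋ)
    where
    fan∈ℋ : ℋ (suc m) N ℓ m fan
    fan∈ℋ = Δ-fan , [ m ] , diameter , [ ℕ.≤-refl ]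
    e-fan≤m+ℓ : e fan ≤ m + ℓ
    e-fan≤m+ℓ = subst (e fan ≤_) (ℕ.+-comm ℓ m) e-fan≤
    bound : ∀ G → ℋ (suc m) N ℓ m G → m + ℓ ≤ e G
    bound G (Δ≡ℓ , D , diam , D≤) = subst (_≤ e G) (trans (cong (_+ m) Δ≡ℓ) (ℕ.+-comm ℓ m))
      (Δ+m≤e G (subst (0 <_) (sym Δ≡ℓ) (ℕ.≤-trans (s≤s z≤n) 2≤ℓ)) diam D≤)

theorem2p1 : (n : ℕ) → 4 ≤ n →
    ((ℓ : ℕ) → 2 ≤ ℓ → ℓ ≤ n ∸ 1 → IsMinimumSize (n ∸ 1) n ℓ (n ∸ 1) [ n ∸ 1 ])
    × ((ℓ : ℕ) → 2 ≤ ℓ → ℓ ≤ n ∸ 1 → IsMinimumSize (n ∸ 1) n ℓ (n ∸ 2) [ n + ℓ ∸ 2 ])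
-- Here n = 4 + k. The broom has m + 3 vertices and the fan m + 2, whence the two arguments; n + ℓ ∸
-- 2 reduces to the m + ℓ of the fan by computation.
theorem2p1 _ (s≤s (s≤s (s≤s (s≤s (z≤n {k}))))) =
  Broom.minimum-size (suc k) ,
  Fan.minimum-size (suc (suc k))
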